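{- There is an algorithm that, for any stable matching instance with one-sided uncertainty and any given matching $M$, decides whether $M$ is stable and $B$-optimal using $\mathcal{O}(n \log n)$ set queries.
   Context: Two disjoint sets $A$, $B$ of agents with $|A|=|B|=n$. Each $a\in A$ has a strict total order $\prec_a$ on $B$ and each $b\in B$ has a strict total order $\prec_b$ on $A$ ($x\prec_y z$: $y$ prefers $x$ to $z$). A matching is a bijection between $A$ and $B$; it is stable if there is no pair $(a,b)$, $b\neq M(a)$, with $a$ preferring $b$ to $M(a)$ and $b$ preferring $a$ to $M(b)$. A stable matching is $B$-optimal if every agent of $B$ weakly prefers its partner in it to its partner in any other stable matching. One-sided uncertainty: the orders $\prec_a$ ($a\in A$) are known, the orders $\prec_b$ ($b\in B$) are unknown and learned only via queries. A set query $\mathit{top}(b,S)$ for $b\in B$ and $S\subseteq A$ returns $b$'s most preferred element of $S$. The algorithm queries adaptively and its answer must be correct for every $B$-side preference profile consistent with the $A$-side preferences and the answers received. -}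

module Defs where

open import Data.Nat using (ℕ; zero; suc; _+_; _<_)
open import Data.Nat.Properties using (_<?_)
open import Data.Fin using (Fin; toℕ)
open import Data.Fin.Permutation using (Permutation′; _⟨$⟩ʳ_; _⟨$⟩ˡ_)
open import Data.Bool using (Bool; true; false; T)
open import Data.List using (List; []; _∷_)
open import Data.Product using (_×_)
open import Data.Sum using (_⊎_)
open import Relation.Nullary using (¬_; yes; no)
open import Relation.Binary.PropositionalEquality using (_≡_; _≢_)

-- Agents: A = Fin n and B = Fin n (two disjoint copies).
-- A strict total order on a finite set of size n is represented by a
-- ranking bijection onto Fin n (rank 0 = most preferred).
Ranking : ℕ → Set
Ranking n = Permutation′ n

rank : ∀ {n} → Ranking n → Fin n → ℕ
rank r x = toℕ (r ⟨$⟩ʳ x)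

_≺[_]_ : ∀ {n} → Fin n → Ranking n → Fin n → Set
x ≺[ r ] z = rank r x < rank r z

Profile : ℕ → Set
Profile n = Fin n → Ranking n

-- A matching: a bijection A → B.  M ⟨$⟩ʳ a = partner of a, M ⟨$⟩ˡ b = partner of b.
Matching : ℕ → Set
Matching n = Permutation′ n

Stable : ∀ {n} → Profile n → Profile n → Matching n → Set
Stable {n} pA pB M =
  (a b : Fin n) → b ≢ M ⟨$⟩ʳ a →
  ¬ ((b ≺[ pA a ] (M ⟨$⟩ʳ a)) × (a ≺[ pB b ] (M ⟨$⟩ˡ b)))

BOptimal : ∀ {n} → Profile n → Profile n → Matching n → Set
BOptimal {n} pA pB M =
  Stable pA pB M ×
  ((M' : Matching n) → Stable pA pB M' → (b : Fin n) →
     (M ⟨$⟩ˡ b ≡ M' ⟨$⟩ˡ b) ⊎ ((M ⟨$⟩ˡ b) ≺[ pB b ] (M' ⟨$⟩ˡ b)))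

-- Set query top(b,S): the most preferred element of S under b's order.
-- The (nonempty) set S ⊆ A is given as a nonempty list x ∷ xs.
topOf : ∀ {n} → Ranking n → Fin n → List (Fin n) → Fin n
topOf r x [] = x
topOf r x (y ∷ ys) with rank r y <? rank r x
... | yes _ = topOf r y ys
... | no  _ = topOf r x ys

-- Adaptive query algorithms (decision trees): either stop with an answer,
-- or ask the set query top(b, x ∷ xs) and continue depending on the answer.
data QTree (n : ℕ) : Set where
  done : Bool → QTree n
  ask  : (b : Fin n) (x : Fin n) (xs : List (Fin n)) → (Fin n → QTree n) → QTree n

output : ∀ {n} → QTree n → Profile n → Bool
output (done v) pB = v
output (ask b x xs k) pB = output (k (topOf (pB b) x xs)) pB

queries : ∀ {n} → QTree n → Profile n → ℕ
queries (done v) pB = 0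
queries (ask b x xs k) pB = suc (queries (k (topOf (pB b) x xs)) pB)

-- An algorithm: given n, the known A-side profile and a matching M, a query tree.
Algorithm : Set
Algorithm = (n : ℕ) → Profile n → Matching n → QTree n

{-# OPTIONS --safe #-}

-- Stability costs one query per b: M(b) must be the top of itself together
-- with all a that prefer b to M(a).  For stable M, let t(a) be the first b
-- below M(a) on a's list that prefers a to M(b), and t(a) = M(a) if there is
-- none.  M is B-optimal iff the map M⁻¹ ∘ t on A has no cycle other than
-- fixed points: rotating a cycle gives a stable matching better for B, and
-- conversely the agents made worse off by a B-improvement form a set that is
-- closed under the map and contains no fixed point.
--
-- All t(a) are found by one parallel binary search.  In a sweep, each b is
-- asked for its top among M(b) and those a which have b in the first half of
-- their search interval.  The answer M(b) settles b for the whole sweep; an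
-- answer a truncates a's interval just before b and retires a for the sweep.
-- So a sweep takes at most 2n queries and halves every interval.

module Submission where

open import Defs
open import Data.Nat using (ℕ; zero; suc; _+_; _*_; _∸_; _^_; _≤_; _<_; z≤n; s≤s; z<s; ⌊_/2⌋; ⌈_/2⌉)
open import Data.Nat.Logarithm using (⌈log₂_⌉; ⌈log₂⌉-mono-≤; ⌈log₂⌈n/2⌉⌉≡⌈log₂n⌉∸1)
open import Data.Nat.GeneralisedArithmetic using (fold; fold-+)
open import Data.Nat.Induction using (<-rec)
open import Data.Nat.Properties hiding (_≟_)
open import Data.Fin using (Fin; toℕ; fromℕ<; _≟_)
open import Data.Fin.Properties using (toℕ<n; toℕ-injective; toℕ-fromℕ<; pigeonhole; all?)
open import Data.Fin.Permutation
  using (_⟨$⟩ʳ_; _⟨$⟩ˡ_; inverseˡ; inverseʳ; permutation; _∘ₚ_; Permutation′)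
open import Data.Bool using (Bool; true; T; _∧_; if_then_else_)
open import Data.Bool.Properties using (T-∧)
open import Data.List using (List; []; _∷_; length; filter; allFin)
open import Data.List.Properties using (length-tabulate; filter-notAll)
open import Data.List.Membership.Propositional using (_∈_; lose)
open import Data.List.Membership.Propositional.Properties using (∈-filter⁺; ∈-filter⁻; ∈-allFin)
open import Data.List.Relation.Unary.Any using (here; there)
open import Data.Product using (Σ; ∃; ∃₂; _×_; _,_; proj₁; proj₂)
open import Data.Sum using (_⊎_; inj₁; inj₂)
open import Data.Unit using (tt)
open import Data.Empty using (⊥)
open import Function using (_∘_)
open import Function.Bundles using (_⇔_; mk⇔; Equivalence)
open import Function.Definitions using (Injective)
open import Relation.Nullary using (¬_; Dec; yes; no; contradiction)
open import Relation.Nullary.Decidable using (⌊_⌋; toWitness; fromWitness; ¬?; _×-dec_)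
open import Relation.Binary.Definitions using (tri<; tri≈; tri>)
open import Relation.Binary.PropositionalEquality

-- Iterating a self-map of a finite set.

fold-split : ∀ {n} (f : Fin n → Fin n) x {i k} → i ≤ k → fold x f k ≡ fold (fold x f i) f (k ∸ i)
fold-split f x {i} {k} i≤k = trans (cong (fold x f) (sym (m∸n+n≡m i≤k))) (fold-+ x f (k ∸ i))

fold-shift : ∀ {n} (f : Fin n → Fin n) x k → fold (f x) f k ≡ f (fold x f k)
fold-shift f x zero    = refl
fold-shift f x (suc k) = cong f (fold-shift f x k)

fold-fixed : ∀ {n} (f : Fin n → Fin n) {x} → f x ≡ x → ∀ k → fold x f k ≡ x
fold-fixed f fx zero    = refl
fold-fixed f fx (suc k) = trans (cong f (fold-fixed f fx k)) fx

fold-closed : ∀ {n} {f : Fin n → Fin n} {P : Fin n → Set} → (∀ {x} → P x → P (f x)) →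
              ∀ {x} → P x → ∀ k → P (fold x f k)
fold-closed closed px zero    = px
fold-closed {P = P} closed px (suc k) = closed (fold-closed {P = P} closed px k)

fold-injective : ∀ {n} {f : Fin n → Fin n} → Injective _≡_ _≡_ f →
                 ∀ k {x y} → fold x f k ≡ fold y f k → x ≡ y
fold-injective inj zero    eq = eq
fold-injective inj (suc k) eq = fold-injective inj k (inj eq)

-- Two of the iterates 0 to n coincide by the pigeonhole principle. The bound `i ≤ n` is kept
-- because it shows that n steps suffice to enter a cycle.
eventually-periodic : ∀ {n} (f : Fin n → Fin n) x →
  ∃₂ λ i p → i ≤ n × fold (fold x f i) f (suc p) ≡ fold x f i
eventually-periodic {n} f x with pigeonhole (n<1+n n) (fold x f ∘ toℕ)
... | i , j , i<j , eq = toℕ i , toℕ j ∸ suc (toℕ i) , ≤-pred (toℕ<n i) ,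
  (begin
    fold (fold x f (toℕ i)) f (suc (toℕ j ∸ suc (toℕ i))) ≡⟨ cong (fold _ f) (sym (+-∸-assoc 1 i<j)) ⟩
    fold (fold x f (toℕ i)) f (toℕ j ∸ toℕ i)             ≡⟨ sym (fold-split f x (<⇒≤ i<j)) ⟩
    fold x f (toℕ j)                                      ≡⟨ sym eq ⟩
    fold x f (toℕ i)                                      ∎)
  where open ≡-Reasoning

-- Injectivity cancels the `i` steps that lead into the cycle.
injective⇒periodic : ∀ {n} {f : Fin n → Fin n} → Injective _≡_ _≡_ f →
  ∀ x → ∃ λ p → fold x f (suc p) ≡ x
injective⇒periodic {f = f} inj x with eventually-periodic f x
... | i , p , _ , eq = p , fold-injective inj i
  (begin
    fold (fold x f (suc p)) f i ≡⟨ sym (fold-+ x f i) ⟩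
    fold x f (i + suc p)        ≡⟨ cong (fold x f) (+-comm i (suc p)) ⟩
    fold x f (suc p + i)        ≡⟨ fold-+ x f (suc p) ⟩
    fold (fold x f i) f (suc p) ≡⟨ eq ⟩
    fold x f i                  ∎)
  where open ≡-Reasoning

-- Going once around the cycle through y reaches y again from f y.
closed-backward : ∀ {n} {f : Fin n → Fin n} {P : Fin n → Set} → Injective _≡_ _≡_ f →
  (∀ {x} → P x → P (f x)) → ∀ {y} → P (f y) → P y
closed-backward {f = f} {P} inj closed {y} pfy with injective⇒periodic inj y
... | p , eq = subst P (trans (fold-shift f y p) eq) (fold-closed {P = P} closed pfy p)

module _ {n} (f : Fin n → Fin n) (p : ℕ) where

  Periodic : Fin n → Set
  Periodic x = fold x f (suc p) ≡ x

  periodic? : ∀ x → Dec (Periodic x)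
  periodic? x = fold x f (suc p) ≟ x

  periodic-step : ∀ {x} → Periodic x → Periodic (f x)
  periodic-step {x} eq = trans (fold-shift f x (suc p)) (cong f eq)

  -- `f` permutes its points of period dividing `suc p`, and the `p`-fold iterate inverts it there;
  -- the identity elsewhere extends this to a permutation of the whole set.
  periodic-to : Fin n → Fin n
  periodic-to x with periodic? x
  ... | yes _ = f x
  ... | no  _ = x

  periodic-from : Fin n → Fin n
  periodic-from x with periodic? x
  ... | yes _ = fold x f p
  ... | no  _ = x

  periodic-to-from : ∀ x → periodic-to (periodic-from x) ≡ x
  periodic-to-from x with periodic? x
  ... | no ¬px with periodic? x
  ...   | yes px = contradiction px ¬px
  ...   | no  _  = refl
  periodic-to-from x | yes px with periodic? (fold x f p)
  ...   | yes _  = px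
  ...   | no ¬py = contradiction (fold-closed {P = Periodic} periodic-step px p) ¬py

  periodic-from-to : ∀ x → periodic-from (periodic-to x) ≡ x
  periodic-from-to x with periodic? x
  ... | no ¬px with periodic? x
  ...   | yes px = contradiction px ¬px
  ...   | no  _  = refl
  periodic-from-to x | yes px with periodic? (f x)
  ...   | yes _  = trans (fold-shift f x p) px
  ...   | no ¬py = contradiction (periodic-step px) ¬py

  rotate : Permutation′ n
  rotate = permutation periodic-to periodic-from periodic-to-from periodic-from-to

  rotate-cases : ∀ x → rotate ⟨$⟩ʳ x ≡ f x ⊎ rotate ⟨$⟩ʳ x ≡ x
  rotate-cases x with periodic? x
  ... | yes _ = inj₁ refl
  ... | no  _ = inj₂ refl

  rotate-periodic : ∀ {x} → Periodic x → rotate ⟨$⟩ʳ x ≡ f x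
  rotate-periodic {x} px with periodic? x
  ... | yes _  = refl
  ... | no ¬px = contradiction px ¬px

-- Ranks and blocking pairs.

rank-injective : ∀ {n} (r : Ranking n) {x y} → rank r x ≡ rank r y → x ≡ y
rank-injective r {x} {y} eq = begin
  x                      ≡⟨ sym (inverseˡ r) ⟩
  r ⟨$⟩ˡ (r ⟨$⟩ʳ x)       ≡⟨ cong (r ⟨$⟩ˡ_) (toℕ-injective eq) ⟩
  r ⟨$⟩ˡ (r ⟨$⟩ʳ y)       ≡⟨ inverseˡ r ⟩
  y                      ∎
  where open ≡-Reasoning

-- Equal ranks would make `a` the partner of `b`, which cannot be preferred to itself; the reverse
-- order would make the two a blocking pair.
unblocked : ∀ {n} (pA pB : Profile n) M → Stable pA pB M →
  ∀ {a b} → a ≺[ pB b ] (M ⟨$⟩ˡ b) → (M ⟨$⟩ʳ a) ≺[ pA a ] b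
unblocked pA pB M st {a} {b} a≺ with <-cmp (rank (pA a) (M ⟨$⟩ʳ a)) (rank (pA a) b)
... | tri< Ma≺b _ _ = Ma≺b
... | tri≈ _ eq _ = contradiction a≺ (<-irrefl (cong (rank (pB b))
        (trans (sym (inverseˡ M)) (cong (M ⟨$⟩ˡ_) (rank-injective (pA a) eq)))))
... | tri> _ ¬eq b≺Ma = contradiction (b≺Ma , a≺) (st a b λ { refl → ¬eq refl })

-- Descents and the successor map.

module _ {n} (pA pB : Profile n) (M : Matching n) where

  Desires : Fin n → Fin n → Set
  Desires b a = a ≺[ pB b ] (M ⟨$⟩ˡ b)

  Descent : Fin n → Fin n → Set
  Descent a b = ((M ⟨$⟩ʳ a) ≺[ pA a ] b) × Desires b a

  -- This is all that the optimality argument knows of `t`, and what the search has to deliver. An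
  -- agent with a descent cannot have `t a` equal to its partner, since by `first` the target lies
  -- strictly below the partner.
  record FirstDescent (t : Fin n → Fin n) : Set where
    field
      stays-or-descends : ∀ a → t a ≡ M ⟨$⟩ʳ a ⊎ Descent a (t a)
      first             : ∀ {a b} → Descent a b → Descent a (t a) × ¬ (b ≺[ pA a ] t a)

-- A fixed point of the successor map is an agent without a descent, so
-- the cycles of length at least two are the exposed rotations.
successor : ∀ {n} → Matching n → (Fin n → Fin n) → Fin n → Fin n
successor M t a = M ⟨$⟩ˡ t a

-- After n steps every orbit is on its cycle, so the n-th iterates meet all cycles.
RotationFree : ∀ {n} → Matching n → (Fin n → Fin n) → Set
RotationFree {n} M t = ∀ a → let x = fold a (successor M t) n in successor M t x ≡ x

rotationFree? : ∀ {n} (M : Matching n) t → Dec (RotationFree M t)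
rotationFree? M t = all? λ a → _ ≟ _

-- The cycle criterion for optimality.

module _ {n} {pA pB : Profile n} {M : Matching n} (st : Stable pA pB M)
         {t : Fin n → Fin n} (fd : FirstDescent pA pB M t) where
  open FirstDescent fd

  private
    f : Fin n → Fin n
    f = successor M t

  module _ {M' : Matching n} (st' : Stable pA pB M') where

    Improves : Fin n → Set
    Improves b = (M' ⟨$⟩ˡ b) ≺[ pB b ] (M ⟨$⟩ˡ b)

    private
      -- An `M'`-edge to A followed by an `M`-edge back to B: `ρ` walks along the alternating cycles
      -- of the two matchings.
      ρ : Fin n → Fin n
      ρ b = M ⟨$⟩ʳ (M' ⟨$⟩ˡ b)

      ρ-injective : Injective _≡_ _≡_ ρ
      ρ-injective {x} {y} eq = begin
        x                         ≡⟨ sym (inverseʳ M') ⟩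
        M' ⟨$⟩ʳ (M' ⟨$⟩ˡ x)        ≡⟨ cong (M' ⟨$⟩ʳ_) (trans (sym (inverseˡ M)) (trans (cong (M ⟨$⟩ˡ_) eq) (inverseˡ M))) ⟩
        M' ⟨$⟩ʳ (M' ⟨$⟩ˡ y)        ≡⟨ inverseʳ M' ⟩
        y                         ∎
        where open ≡-Reasoning

    -- Stability of `M'` makes `c` prefer its `M'`-partner to `a`, and for `c` the agent `a` is at
    -- least as good as its `M`-partner.
    improves-above : ∀ {a c} → c ≺[ pA a ] (M' ⟨$⟩ʳ a) → a ≡ M ⟨$⟩ˡ c ⊎ Desires pA pB M c a → Improves c
    improves-above {a} {c} c≺ des with <-cmp (rank (pB c) (M' ⟨$⟩ˡ c)) (rank (pB c) a)
    improves-above c≺ (inj₁ refl) | tri< lt _ _ = lt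
    improves-above c≺ (inj₂ d)    | tri< lt _ _ = <-trans lt d
    improves-above {a} {c} c≺ des | tri≈ _ eq _ = contradiction c≺ (<-irrefl (cong (rank (pA a))
      (trans (sym (inverseʳ M')) (cong (M' ⟨$⟩ʳ_) (rank-injective (pB c) eq)))))
    improves-above c≺ des         | tri> _ _ gt = contradiction (unblocked pA pB M' st' gt) (<-asym c≺)

    -- By stability of `M`, the `M'`-partner of `b` prefers its `M`-partner `ρ b` to `b`, so
    -- `improves-above` applies to it and `ρ b`.
    ρ-improves : ∀ {b} → Improves b → Improves (ρ b)
    ρ-improves {b} imp = improves-above
      (subst (ρ b ≺[ pA (M' ⟨$⟩ˡ b) ]_) (sym (inverseʳ M')) (unblocked pA pB M st imp))
      (inj₁ (sym (inverseˡ M)))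

    Worsens : Fin n → Set
    Worsens a = Improves (M' ⟨$⟩ʳ a)

    worsens⇒descent : ∀ {a} → Worsens a → Descent pA pB M a (M' ⟨$⟩ʳ a)
    worsens⇒descent {a} w = unblocked pA pB M st d , d
      where
      d : Desires pA pB M (M' ⟨$⟩ʳ a) a
      d = subst (_≺[ pB (M' ⟨$⟩ʳ a) ] (M ⟨$⟩ˡ (M' ⟨$⟩ʳ a))) (inverseˡ M') w

    -- The target `t a` is no later than the descent `M' a`, hence improves: by assumption if they
    -- are equal, by `improves-above` otherwise. As `ρ` sends the `M'`-partner of `f a` to `t a`,
    -- improvement is pulled back along the cycle of `ρ`.
    successor-worsens : ∀ {a} → Worsens a → Worsens (f a)
    successor-worsens {a} w = closed-backward {P = Improves} ρ-injective ρ-improves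
      (subst Improves (sym (trans (cong (M ⟨$⟩ʳ_) (inverseˡ M')) (inverseʳ M))) target-improves)
      where
      target-improves : Improves (t a)
      target-improves with first (worsens⇒descent w)
      ... | (_ , d) , ¬M'a≺ta with <-cmp (rank (pA a) (t a)) (rank (pA a) (M' ⟨$⟩ʳ a))
      ... | tri< lt _ _ = improves-above lt (inj₂ d)
      ... | tri≈ _ eq _ = subst Improves (sym (rank-injective (pA a) eq)) w
      ... | tri> _ _ gt = contradiction gt ¬M'a≺ta

    worsens⇒moves : ∀ {a} → Worsens a → f a ≢ a
    worsens⇒moves {a} w fa≡a with first (worsens⇒descent w)
    ... | (Ma≺ta , _) , _ = <-irrefl (cong (rank (pA a)) Ma≡ta) Ma≺ta
      where
      Ma≡ta : M ⟨$⟩ʳ a ≡ t a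
      Ma≡ta = trans (cong (M ⟨$⟩ʳ_) (sym fa≡a)) (inverseʳ M)

    rotationFree⇒¬improves : RotationFree M t → ∀ b → ¬ Improves b
    rotationFree⇒¬improves rf b imp = worsens⇒moves
      (fold-closed {P = Worsens} successor-worsens (subst Improves (sym (inverseʳ M')) imp) n)
      (rf (M' ⟨$⟩ˡ b))

  rotationFree⇒bOptimal : RotationFree M t → BOptimal pA pB M
  rotationFree⇒bOptimal rf = st , better
    where
    better : ∀ M' → Stable pA pB M' → ∀ b →
             M ⟨$⟩ˡ b ≡ M' ⟨$⟩ˡ b ⊎ (M ⟨$⟩ˡ b) ≺[ pB b ] (M' ⟨$⟩ˡ b)
    better M' st' b with <-cmp (rank (pB b) (M ⟨$⟩ˡ b)) (rank (pB b) (M' ⟨$⟩ˡ b))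
    ... | tri< lt _ _ = inj₂ lt
    ... | tri≈ _ eq _ = inj₁ (rank-injective (pB b) eq)
    ... | tri> _ _ gt = contradiction gt (rotationFree⇒¬improves {M'} st' rf b)

  -- Rotating cycles.

  module _ (p : ℕ) where

    rotated : Matching n
    rotated = rotate f p ∘ₚ M

    rotated-cases : ∀ a → rotated ⟨$⟩ʳ a ≡ t a ⊎ rotated ⟨$⟩ʳ a ≡ M ⟨$⟩ʳ a
    rotated-cases a with rotate-cases f p a
    ... | inj₁ eq = inj₁ (trans (cong (M ⟨$⟩ʳ_) eq) (inverseʳ M))
    ... | inj₂ eq = inj₂ (cong (M ⟨$⟩ʳ_) eq)

    stays-or-descends-rotated : ∀ a →
      rotated ⟨$⟩ʳ a ≡ M ⟨$⟩ʳ a ⊎ Descent pA pB M a (rotated ⟨$⟩ʳ a)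
    stays-or-descends-rotated a with rotated-cases a
    ... | inj₂ eq = inj₁ eq
    ... | inj₁ eq rewrite eq = stays-or-descends a

    rotated-improves : ∀ b → rotated ⟨$⟩ˡ b ≡ M ⟨$⟩ˡ b ⊎ (rotated ⟨$⟩ˡ b) ≺[ pB b ] (M ⟨$⟩ˡ b)
    rotated-improves b with stays-or-descends-rotated (rotated ⟨$⟩ˡ b)
    ... | inj₁ eq = inj₁ (trans (sym (inverseˡ M)) (cong (M ⟨$⟩ˡ_) (trans (sym eq) (inverseʳ rotated))))
    ... | inj₂ (_ , d) = inj₂ (subst (λ c → Desires pA pB M c (rotated ⟨$⟩ˡ b)) (inverseʳ rotated) d)

    -- No agent of B loses by the rotation, so in a blocking pair `b` already desires `a` under `M`
    -- and is a descent of `a`. But `a` now holds `t a` or its old partner, and no descent comes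
    -- before either.
    rotated-stable : Stable pA pB rotated
    rotated-stable a b _ (b≺ , a≺) = blocked (rotated-cases a)
      where
      desires : Desires pA pB M b a
      desires with rotated-improves b
      ... | inj₁ eq = subst (a ≺[ pB b ]_) eq a≺
      ... | inj₂ lt = <-trans a≺ lt

      descent : Descent pA pB M a b
      descent = unblocked pA pB M st desires , desires

      blocked : rotated ⟨$⟩ʳ a ≡ t a ⊎ rotated ⟨$⟩ʳ a ≡ M ⟨$⟩ʳ a → ⊥
      blocked (inj₁ eq) = proj₂ (first descent) (subst (b ≺[ pA a ]_) eq b≺)
      blocked (inj₂ eq) = <-asym (proj₁ descent) (subst (b ≺[ pA a ]_) eq b≺)

    bOptimal⇒rotated≗M : BOptimal pA pB M → ∀ b → rotated ⟨$⟩ˡ b ≡ M ⟨$⟩ˡ b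
    bOptimal⇒rotated≗M (_ , opt) b with rotated-improves b | opt rotated rotated-stable b
    ... | inj₁ eq | _       = eq
    ... | inj₂ _  | inj₁ eq = sym eq
    ... | inj₂ lt | inj₂ gt = contradiction gt (<-asym lt)

    bOptimal⇒periodic-fixed : BOptimal pA pB M → ∀ {x} → Periodic f p x → f x ≡ x
    bOptimal⇒periodic-fixed opt {x} px = begin
      f x                              ≡⟨ sym (rotate-periodic f p px) ⟩
      rotate f p ⟨$⟩ʳ x                 ≡⟨ sym (inverseˡ M) ⟩
      M ⟨$⟩ˡ (rotated ⟨$⟩ʳ x)            ≡⟨ sym (bOptimal⇒rotated≗M opt _) ⟩
      rotated ⟨$⟩ˡ (rotated ⟨$⟩ʳ x)      ≡⟨ inverseˡ rotated ⟩
      x                                ∎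
      where open ≡-Reasoning

  bOptimal⇒rotationFree : BOptimal pA pB M → RotationFree M t
  bOptimal⇒rotationFree opt a with eventually-periodic f a
  ... | i , p , i≤n , eq = subst (λ x → f x ≡ x) (sym reached) fixed
    where
    fixed : f (fold a f i) ≡ fold a f i
    fixed = bOptimal⇒periodic-fixed p opt eq

    -- The orbit is constant from step `i` on, and `i ≤ n`.
    reached : fold a f n ≡ fold a f i
    reached = trans (fold-split f a i≤n) (fold-fixed f fixed (n ∸ i))

-- Set queries and query programs.

topOf-spec : ∀ {n} (r : Ranking n) x xs →
  (topOf r x xs ≡ x × (∀ {y} → y ∈ xs → ¬ (y ≺[ r ] x))) ⊎
  (topOf r x xs ∈ xs × topOf r x xs ≺[ r ] x)
topOf-spec r x [] = inj₁ (refl , λ ())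
topOf-spec r x (y ∷ ys) with rank r y <? rank r x
topOf-spec r x (y ∷ ys) | yes y<x with topOf-spec r y ys
... | inj₁ (eq , _)  = inj₂ (here eq , subst (_≺[ r ] x) (sym eq) y<x)
... | inj₂ (∈ys , lt) = inj₂ (there ∈ys , <-trans lt y<x)
topOf-spec r x (y ∷ ys) | no y≮x with topOf-spec r x ys
... | inj₁ (eq , none) = inj₁ (eq , λ { (here refl) → y≮x ; (there ∈ys) → none ∈ys })
... | inj₂ (∈ys , lt)  = inj₂ (there ∈ys , lt)

-- Query trees with results of any type, so that subroutines can be sequenced and their costs added.
data Prog (n : ℕ) (X : Set) : Set where
  pure  : X → Prog n X
  query : (b x : Fin n) (xs : List (Fin n)) → (Fin n → Prog n X) → Prog n X

module _ {n : ℕ} where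

  infixl 1 _>>=_
  _>>=_ : ∀ {X Y} → Prog n X → (X → Prog n Y) → Prog n Y
  pure v         >>= g = g v
  query b x xs k >>= g = query b x xs λ y → k y >>= g

  toQTree : Prog n Bool → QTree n
  toQTree (pure v)         = done v
  toQTree (query b x xs k) = ask b x xs λ y → toQTree (k y)

  module _ (pB : Profile n) where

    run : ∀ {X} → Prog n X → X
    run (pure v)         = v
    run (query b x xs k) = run (k (topOf (pB b) x xs))

    cost : ∀ {X} → Prog n X → ℕ
    cost (pure v)         = 0
    cost (query b x xs k) = suc (cost (k (topOf (pB b) x xs)))

    run->>= : ∀ {X Y} (m : Prog n X) {g : X → Prog n Y} → run (m >>= g) ≡ run (g (run m))
    run->>= (pure v)         = refl
    run->>= (query b x xs k) = run->>= (k _)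

    cost->>= : ∀ {X Y} (m : Prog n X) {g : X → Prog n Y} →
               cost (m >>= g) ≡ cost m + cost (g (run m))
    cost->>= (pure v)         = refl
    cost->>= (query b x xs k) = cong suc (cost->>= (k _))

    output-toQTree : ∀ m → output (toQTree m) pB ≡ run m
    output-toQTree (pure v)         = refl
    output-toQTree (query b x xs k) = output-toQTree (k _)

    queries-toQTree : ∀ m → queries (toQTree m) pB ≡ cost m
    queries-toQTree (pure v)         = refl
    queries-toQTree (query b x xs k) = cong suc (queries-toQTree (k _))

-- Testing stability.

module _ {n} (pA : Profile n) (M : Matching n) where

  wooers : Fin n → List (Fin n)
  wooers b = filter (λ a → rank (pA a) b <? rank (pA a) (M ⟨$⟩ʳ a)) (allFin n)

  checkStable : List (Fin n) → Prog n Bool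
  checkStable []       = pure true
  checkStable (b ∷ bs) = query b (M ⟨$⟩ˡ b) (wooers b) λ x →
    checkStable bs >>= λ ok → pure (⌊ x ≟ M ⟨$⟩ˡ b ⌋ ∧ ok)

  module _ (pB : Profile n) where

    Unblocked : Fin n → Set
    Unblocked b = ∀ a → ¬ ((b ≺[ pA a ] (M ⟨$⟩ʳ a)) × Desires pA pB M b a)

    -- The partner of `b` is the first element of the queried set, so it is returned exactly when no
    -- wooer beats it.
    top-unblocked : ∀ b → topOf (pB b) (M ⟨$⟩ˡ b) (wooers b) ≡ M ⟨$⟩ˡ b ⇔ Unblocked b
    top-unblocked b with topOf-spec (pB b) (M ⟨$⟩ˡ b) (wooers b)
    ... | inj₁ (eq , none) = mk⇔ (λ _ a (b≺ , d) → none (∈-filter⁺ _ (∈-allFin a) b≺) d) (λ _ → eq)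
    ... | inj₂ (∈ws , lt)  = mk⇔ (λ eq → contradiction lt (<-irrefl (cong (rank (pB b)) eq)))
      (λ un → contradiction (proj₂ (∈-filter⁻ _ {xs = allFin n} ∈ws) , lt) (un _))

    accepts : Fin n → Bool
    accepts b = ⌊ topOf (pB b) (M ⟨$⟩ˡ b) (wooers b) ≟ M ⟨$⟩ˡ b ⌋

    accepts⇔unblocked : ∀ b → T (accepts b) ⇔ Unblocked b
    accepts⇔unblocked b = mk⇔ (Equivalence.to (top-unblocked b) ∘ toWitness)
                              (fromWitness ∘ Equivalence.from (top-unblocked b))

    run-checkStable : ∀ b bs → run pB (checkStable (b ∷ bs)) ≡ accepts b ∧ run pB (checkStable bs)
    run-checkStable b bs = run->>= pB (checkStable bs)

    checkStable-correct : ∀ bs → T (run pB (checkStable bs)) ⇔ (∀ {b} → b ∈ bs → Unblocked b)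
    checkStable-correct []       = mk⇔ (λ _ ()) (λ _ → tt)
    checkStable-correct (b ∷ bs) rewrite run-checkStable b bs = mk⇔
      (λ ok → let ok₁ , ok₂ = Equivalence.to (T-∧ {accepts b}) ok in λ
        { (here refl) → Equivalence.to (accepts⇔unblocked b) ok₁
        ; (there c∈)  → Equivalence.to (checkStable-correct bs) ok₂ c∈ })
      (λ un → Equivalence.from (T-∧ {accepts b})
        ( Equivalence.from (accepts⇔unblocked b) (un (here refl))
        , Equivalence.from (checkStable-correct bs) (λ c∈ → un (there c∈))))

    checkStable⇔stable : T (run pB (checkStable (allFin n))) ⇔ Stable pA pB M
    checkStable⇔stable = mk⇔
      (λ ok a b _ → Equivalence.to (checkStable-correct (allFin n)) ok (∈-allFin b) a)
      (λ st → Equivalence.from (checkStable-correct (allFin n)) λ {b} _ a (b≺ , d) →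
        -- An agent strictly above the partner of `a` is not that partner.
        st a b (λ { refl → <-irrefl refl b≺ }) (b≺ , d))

    cost-checkStable : ∀ bs → cost pB (checkStable bs) ≡ length bs
    cost-checkStable []       = refl
    cost-checkStable (b ∷ bs) = cong suc (trans (cost->>= pB (checkStable bs))
      (trans (+-identityʳ _) (cost-checkStable bs)))

-- Parallel binary search.

record Interval : Set where
  constructor ⟦_,_⟩
  field lo hi : ℕ

-- `hi` is carried along with the searched part because the ranks from `lo + len` up to `hi` are
-- left to later sweeps.
record Window : Set where
  constructor window
  field lo len hi : ℕ

-- A sweep searches the ranks lo, …, lo + len − 1.
halve : Interval → Window
halve ⟦ lo , hi ⟩ = window lo ⌈ hi ∸ lo /2⌉ hi

settle : Window → Interval
settle (window lo len hi) = ⟦ lo + len , hi ⟩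

-- Length 0 retires the agent for the sweep. `lo` stays, since an earlier descent may still lie
-- between `lo` and `r`.
strike : ℕ → Window → Window
strike r (window lo _ _) = window lo 0 r

Covers : Window → ℕ → Set
Covers (window lo len _) r = lo ≤ r × r < lo + len

covers? : ∀ w r → Dec (Covers w r)
covers? (window lo len _) r = lo ≤? r ×-dec r <? lo + len

strike-covers-nothing : ∀ s w r → ¬ Covers (strike s w) r
strike-covers-nothing s w r (lo≤r , r<) = <⇒≱ r< (≤-trans (≤-reflexive (+-identityʳ _)) lo≤r)

module _ {n} (pA : Profile n) (M : Matching n) where

  strikeAt : Fin n → Fin n → (Fin n → Window) → Fin n → Window
  strikeAt b x W a with a ≟ x
  ... | yes _ = strike (rank (pA a) b) (W a)
  ... | no  _ = W a

  candidates : Fin n → List (Fin n) → (Fin n → Window) → List (Fin n)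
  candidates b us W = filter (λ a → covers? (W a) (rank (pA a) b)) us

  -- us lists the agents not yet struck in this sweep; the fuel bounds its length,
  -- so stopping when it runs out loses nothing.
  sweep : List (Fin n) → ℕ → List (Fin n) → (Fin n → Window) → Prog n (Fin n → Interval)
  sweep []       _       us W = pure (settle ∘ W)
  sweep (b ∷ bs) zero    us W = pure (settle ∘ W)
  sweep (b ∷ bs) (suc m) us W = query b (M ⟨$⟩ˡ b) (candidates b us W) λ x → if ⌊ x ≟ M ⟨$⟩ˡ b ⌋
    then sweep bs (suc m) us W
    else sweep (b ∷ bs) m (filter (λ a → ¬? (a ≟ x)) us) (strikeAt b x W)

  sweeps : ℕ → (Fin n → Interval) → Prog n (Fin n → Interval)
  sweeps zero    I = pure I
  sweeps (suc k) I = sweep (allFin n) n (allFin n) (halve ∘ I) >>= sweeps k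

  initial : Fin n → Interval
  initial a = ⟦ suc (rank (pA a) (M ⟨$⟩ʳ a)) , n ⟩

  -- hi = n encodes that no descent was found.
  target : (Fin n → Interval) → Fin n → Fin n
  target I a with Interval.hi (I a) <? n
  ... | yes hi<n = pA a ⟨$⟩ˡ fromℕ< hi<n
  ... | no  _    = M ⟨$⟩ʳ a

  -- Cost and correctness of the search.

  module _ (pB : Profile n) where

    -- Every query uses up either an agent of the list or a unit of fuel.
    cost-sweep : ∀ bs m us W → cost pB (sweep bs m us W) ≤ length bs + m
    cost-sweep []       m       us W = z≤n
    cost-sweep (b ∷ bs) zero    us W = z≤n
    cost-sweep (b ∷ bs) (suc m) us W with topOf (pB b) (M ⟨$⟩ˡ b) (candidates b us W) ≟ M ⟨$⟩ˡ b
         | cost-sweep bs (suc m) | cost-sweep (b ∷ bs) m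
    ... | yes _ | tail | _     = s≤s (tail us W)
    ... | no  _ | _    | again = s≤s (≤-trans (again _ _) (≤-reflexive (sym (+-suc (length bs) m))))

    cost-sweeps : ∀ k I → cost pB (sweeps k I) ≤ k * (n + n)
    cost-sweeps zero    I = z≤n
    cost-sweeps (suc k) I = begin
      cost pB (sweeps (suc k) I)                          ≡⟨ cost->>= pB first-sweep ⟩
      cost pB first-sweep + cost pB (sweeps k _)          ≤⟨ +-mono-≤ (cost-sweep (allFin n) n _ _) (cost-sweeps k _) ⟩
      length (allFin n) + n + k * (n + n)                 ≡⟨ cong (λ l → l + n + k * (n + n)) (length-tabulate {n = n} _) ⟩
      suc k * (n + n)                                     ∎
      where
      open ≤-Reasoning
      first-sweep = sweep (allFin n) n (allFin n) (halve ∘ I)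

    -- Invariant between sweeps: the first descent, if there is one, has rank at least `lo` and at
    -- most `hi`. For `hi` equal to n, `landed` is vacuous.
    record Located (u : ℕ) (a : Fin n) (I : Interval) : Set where
      open Interval I
      field
        above   : rank (pA a) (M ⟨$⟩ʳ a) < lo
        cleared : ∀ b → rank (pA a) b < lo → ¬ Descent pA pB M a b
        landed  : ∀ b → rank (pA a) b ≡ hi → Descent pA pB M a b
        narrow  : hi ∸ lo < u

    -- Invariant within a sweep. `narrow` bounds the interval left by settling, `short` the one left
    -- by a strike. `pending` says that agents of B already passed desire nobody whose window covers
    -- them; this persists because a strike only empties windows.
    record Tracks (u : ℕ) (bs us : List (Fin n)) (a : Fin n) (w : Window) : Set where
      open Window w
      field
        above   : rank (pA a) (M ⟨$⟩ʳ a) < lo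
        cleared : ∀ b → rank (pA a) b < lo → ¬ Descent pA pB M a b
        landed  : ∀ b → rank (pA a) b ≡ hi → Descent pA pB M a b
        narrow  : hi ∸ (lo + len) < u
        short   : len ≤ u
        pending : ∀ b → Covers w (rank (pA a) b) → Desires pA pB M b a → b ∈ bs
        unhit   : ∀ b → Covers w (rank (pA a) b) → a ∈ us

    settle-located : ∀ {u bs us a w} → Tracks u bs us a w →
      (∀ b → Covers w (rank (pA a) b) → ¬ Desires pA pB M b a) → Located u a (settle w)
    settle-located {a = a} {window lo len hi} tr none = record
      { above = ≤-trans above (m≤m+n lo len) ; cleared = cleared′ ; landed = landed ; narrow = narrow }
      where
      open Tracks tr
      cleared′ : ∀ b → rank (pA a) b < lo + len → ¬ Descent pA pB M a b
      cleared′ b r< desc with rank (pA a) b <? lo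
      ... | yes r<lo = cleared b r<lo desc
      ... | no  r≮lo = none b (≮⇒≥ r≮lo , r<) (proj₂ desc)

    halve-tracks : ∀ {u a I} → Located (u + u) a I → Tracks u (allFin n) (allFin n) a (halve I)
    halve-tracks {u} {a} {⟦ lo , hi ⟩} loc = record
      { above = above ; cleared = cleared ; landed = landed
      ; narrow = ≤-trans (s≤s (≤-reflexive upper)) ⌊w/2⌋<u
      -- `⌈ w /2⌉` unfolds to `⌊ suc w /2⌋`, and `narrow` says that `suc w` is at most `u + u`.
      ; short = ≤-trans (⌊n/2⌋-mono narrow) (≤-reflexive (sym (n≡⌊n+n/2⌋ u)))
      ; pending = λ b _ _ → ∈-allFin b ; unhit = λ _ _ → ∈-allFin a }
      where
      open Located loc
      w = hi ∸ lo
      upper : hi ∸ (lo + ⌈ w /2⌉) ≡ ⌊ w /2⌋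
      upper = begin
        hi ∸ (lo + ⌈ w /2⌉)               ≡⟨ sym (∸-+-assoc hi lo ⌈ w /2⌉) ⟩
        w ∸ ⌈ w /2⌉                       ≡⟨ cong (_∸ ⌈ w /2⌉) (sym (⌊n/2⌋+⌈n/2⌉≡n w)) ⟩
        ⌊ w /2⌋ + ⌈ w /2⌉ ∸ ⌈ w /2⌉       ≡⟨ m+n∸n≡m ⌊ w /2⌋ ⌈ w /2⌉ ⟩
        ⌊ w /2⌋                           ∎
        where open ≡-Reasoning
      ⌊w/2⌋<u : ⌊ w /2⌋ < u
      ⌊w/2⌋<u = ≰⇒> λ u≤ → <⇒≱ narrow (≤-trans
        (+-mono-≤ u≤ (≤-trans u≤ (⌊n/2⌋≤⌈n/2⌉ w))) (≤-reflexive (⌊n/2⌋+⌈n/2⌉≡n w)))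

    sweep-located : ∀ {u} bs m us W → length us ≤ m → (∀ a → Tracks u bs us a (W a)) →
                    ∀ a → Located u a (run pB (sweep bs m us W) a)
    sweep-located []       m       us W len≤ tr a =
      settle-located (tr a) λ b cov d → contradiction (Tracks.pending (tr a) b cov d) λ ()
    -- Without fuel no unstruck agent is left, so by `unhit` every window is empty.
    sweep-located (b ∷ bs) zero    [] W len≤ tr a =
      settle-located (tr a) λ c cov _ → contradiction (Tracks.unhit (tr a) c cov) λ ()
    sweep-located {u} (b ∷ bs) (suc m) us W len≤ tr
      with topOf (pB b) (M ⟨$⟩ˡ b) (candidates b us W) ≟ M ⟨$⟩ˡ b
         | topOf-spec (pB b) (M ⟨$⟩ˡ b) (candidates b us W)
         | sweep-located {u} bs (suc m) | sweep-located {u} (b ∷ bs) m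
    ... | yes eq | inj₂ (_ , lt)   | _ | _ = contradiction lt (<-irrefl (cong (rank (pB b)) eq))
    ... | no neq | inj₁ (eq , _)   | _ | _ = contradiction eq neq
    -- By `unhit` the candidates are all agents whose window covers `b`; none beats its partner, so
    -- `b` can be passed.
    ... | yes _  | inj₁ (_ , none) | tail | _ = tail us W len≤ λ a → record
      { Tracks (tr a) ; pending = λ c cov d → pending-tail a c cov d (Tracks.pending (tr a) c cov d) }
      where
      pending-tail : ∀ a c → Covers (W a) (rank (pA a) c) → Desires pA pB M c a → c ∈ b ∷ bs → c ∈ bs
      pending-tail a c cov d (here refl) = contradiction d (none (∈-filter⁺ _ (Tracks.unhit (tr a) c cov) cov))
      pending-tail a c cov d (there c∈)  = c∈
    -- The answer comes from `us`, so removing it shortens the list and pays for the fuel.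
    ... | no _   | inj₂ (x∈ , x≺)  | _ | again = again us′ (strikeAt b x W)
      (≤-pred (≤-trans (filter-notAll _ us (lose x∈us λ ¬eq → ¬eq refl)) len≤)) struck
      where
      x   = topOf (pB b) (M ⟨$⟩ˡ b) (candidates b us W)
      us′ = filter (λ a → ¬? (a ≟ x)) us
      x∈us  = proj₁ (∈-filter⁻ (λ a → covers? (W a) (rank (pA a) b)) {xs = us} x∈)
      x-cov = proj₂ (∈-filter⁻ (λ a → covers? (W a) (rank (pA a) b)) {xs = us} x∈)

      struck : ∀ a → Tracks u (b ∷ bs) us′ a (strikeAt b x W a)
      struck a with a ≟ x
      ... | no a≢x = record
        { Tracks (tr a) ; unhit = λ c cov → ∈-filter⁺ _ (Tracks.unhit (tr a) c cov) a≢x }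
      ... | yes a≡x = record
        { above   = above
        ; cleared = cleared
        ; landed  = λ c eq → subst (Descent pA pB M a) (sym (rank-injective (pA a) eq))
            (<-≤-trans above (proj₁ cov) , subst (Desires pA pB M b) (sym a≡x) x≺)
        -- The struck rank is below `lo + len`, so the new width is less than `len`, which `short`
        -- bounds by `u`.
        ; narrow  = subst (λ l → rank (pA a) b ∸ l < u) (sym (+-identityʳ lo))
            (<-≤-trans (∸-monoˡ-< (proj₂ cov) (proj₁ cov)) (≤-trans (≤-reflexive (m+n∸m≡n lo len)) short))
        ; short   = z≤n
        ; pending = λ c cov′ _ → contradiction cov′ (strike-covers-nothing (rank (pA a) b) (W a) (rank (pA a) c))
        ; unhit   = λ c cov′ → contradiction cov′ (strike-covers-nothing (rank (pA a) b) (W a) (rank (pA a) c))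
        }
        where
        open Tracks (tr a)
        open Window (W a)
        cov : Covers (W a) (rank (pA a) b)
        cov = subst (λ a → Covers (W a) (rank (pA a) b)) (sym a≡x) x-cov

    sweeps-located : ∀ k I → (∀ a → Located (2 ^ k) a (I a)) → ∀ a → Located 1 a (run pB (sweeps k I) a)
    sweeps-located zero    I loc = loc
    sweeps-located (suc k) I loc a
      rewrite run->>= pB (sweep (allFin n) n (allFin n) (halve ∘ I)) {sweeps k}
      = sweeps-located k _ (sweep-located (allFin n) n (allFin n) _ (≤-reflexive (length-tabulate {n = n} _))
          λ a → halve-tracks (subst (λ u → Located u a (I a)) (cong (2 ^ k +_) (+-identityʳ _)) (loc a))) a

    initial-located : ∀ {u} → n ≤ u → ∀ a → Located u a (initial a)
    initial-located n≤u a = record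
      { above   = ≤-refl
      ; cleared = λ b b≤ (Ma≺b , _) → <⇒≱ Ma≺b (≤-pred b≤)
      ; landed  = λ b eq → contradiction (toℕ<n _) (<-irrefl eq)
      ; narrow  = <-≤-trans (∸-monoʳ-< z<s (toℕ<n (pA a ⟨$⟩ʳ (M ⟨$⟩ʳ a)))) n≤u
      }

    target-firstDescent : ∀ {I} → (∀ a → Located 1 a (I a)) → FirstDescent pA pB M (target I)
    target-firstDescent {I} loc = record { stays-or-descends = stays ; first = first }
      where
      rank-target : ∀ a (hi<n : Interval.hi (I a) < n) → rank (pA a) (pA a ⟨$⟩ˡ fromℕ< hi<n) ≡ Interval.hi (I a)
      rank-target a hi<n = trans (cong toℕ (inverseʳ (pA a))) (toℕ-fromℕ< hi<n)

      stays : ∀ a → target I a ≡ M ⟨$⟩ʳ a ⊎ Descent pA pB M a (target I a)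
      stays a with Interval.hi (I a) <? n
      ... | yes hi<n = inj₂ (Located.landed (loc a) _ (rank-target a hi<n))
      ... | no  _    = inj₁ refl

      first : ∀ {a b} → Descent pA pB M a b → Descent pA pB M a (target I a) × ¬ (b ≺[ pA a ] target I a)
      first {a} {b} desc = first′
        where
        open Located (loc a)
        open Interval (I a)
        hi≤b : hi ≤ rank (pA a) b
        -- Width below 1 means `hi ≤ lo`, and no descent has rank below `lo`.
        hi≤b = ≤-trans (m∸n≡0⇒m≤n (n<1⇒n≡0 narrow)) (≮⇒≥ λ b<lo → cleared b b<lo desc)

        first′ : Descent pA pB M a (target I a) × ¬ (b ≺[ pA a ] target I a)
        first′ with hi <? n
        ... | yes hi<n = landed _ (rank-target a hi<n) ,
                         λ b≺ → <⇒≱ b≺ (≤-trans (≤-reflexive (rank-target a hi<n)) hi≤b)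
        ... | no  hi≮n = contradiction (≤-<-trans hi≤b (toℕ<n _)) hi≮n

-- Logarithmic bound and assembly.

n≤2^⌈log₂n⌉ : ∀ n → n ≤ 2 ^ ⌈log₂ n ⌉
n≤2^⌈log₂n⌉ = <-rec _ go
  where
  go : ∀ n → (∀ {m} → m < n → m ≤ 2 ^ ⌈log₂ m ⌉) → n ≤ 2 ^ ⌈log₂ n ⌉
  go zero                _  = z≤n
  go (suc zero)          _  = s≤s z≤n
  go n@(suc (suc k))     ih = begin
    n                               ≡⟨ sym (⌊n/2⌋+⌈n/2⌉≡n n) ⟩
    ⌊ n /2⌋ + h                     ≤⟨ +-monoˡ-≤ h (⌊n/2⌋≤⌈n/2⌉ n) ⟩
    h + h                           ≡⟨ cong (h +_) (sym (+-identityʳ h)) ⟩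
    2 * h                           ≤⟨ *-monoʳ-≤ 2 (ih (⌈n/2⌉<n k)) ⟩
    2 ^ suc ⌈log₂ h ⌉               ≡⟨ cong (λ l → 2 ^ suc l) (⌈log₂⌈n/2⌉⌉≡⌈log₂n⌉∸1 n) ⟩
    -- The truncated subtraction is exact since n is at least 2 here.
    2 ^ suc (⌈log₂ n ⌉ ∸ 1)         ≡⟨ cong (2 ^_) (m+[n∸m]≡n {1} (⌈log₂⌉-mono-≤ {2} {n} (s≤s (s≤s z≤n)))) ⟩
    2 ^ ⌈log₂ n ⌉                   ∎
    where
    open ≤-Reasoning
    h = ⌈ n /2⌉

module _ {n} (pA : Profile n) (M : Matching n) where

  learn : Prog n (Fin n → Interval)
  learn = sweeps pA M ⌈log₂ n ⌉ (initial pA M)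

  -- The search runs whatever the stability test returned; the conjunction overrides its result if
  -- the test failed.
  decide : Prog n Bool
  decide = checkStable pA M (allFin n) >>= λ ok → learn >>= λ I →
    pure (ok ∧ ⌊ rotationFree? M (target pA M I) ⌋)

  module _ (pB : Profile n) where

    private
      t : Fin n → Fin n
      t = target pA M (run pB learn)

    learn-firstDescent : FirstDescent pA pB M t
    learn-firstDescent = target-firstDescent pA M pB
      (sweeps-located pA M pB ⌈log₂ n ⌉ _ (initial-located pA M pB (n≤2^⌈log₂n⌉ n)))

    run-decide : run pB decide ≡ run pB (checkStable pA M (allFin n)) ∧ ⌊ rotationFree? M t ⌋
    run-decide = trans (run->>= pB (checkStable pA M (allFin n))) (run->>= pB learn)

    decide-correct : T (run pB decide) ⇔ (Stable pA pB M × BOptimal pA pB M)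
    decide-correct rewrite run-decide = mk⇔
      (λ ok → let ok₁ , ok₂ = Equivalence.to (T-∧ {run pB (checkStable pA M (allFin n))}) ok
                  st = Equivalence.to (checkStable⇔stable pA M pB) ok₁
              in st , rotationFree⇒bOptimal {pA = pA} {pB} {M} st learn-firstDescent (toWitness ok₂))
      (λ (st , opt) → Equivalence.from (T-∧ {run pB (checkStable pA M (allFin n))})
        ( Equivalence.from (checkStable⇔stable pA M pB) st
        , fromWitness (bOptimal⇒rotationFree {pA = pA} {pB} {M} st learn-firstDescent opt)))

    cost-decide : cost pB decide ≤ n + ⌈log₂ n ⌉ * (n + n)
    cost-decide = begin
      cost pB decide                                  ≡⟨ cost->>= pB (checkStable pA M (allFin n)) ⟩
      cost pB (checkStable pA M (allFin n)) + _       ≡⟨ cong₂ _+_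
        (trans (cost-checkStable pA M pB (allFin n)) (length-tabulate {n = n} _))
        (trans (cost->>= pB learn) (+-identityʳ _)) ⟩
      n + cost pB learn                               ≤⟨ +-monoʳ-≤ n (cost-sweeps pA M pB ⌈log₂ n ⌉ _) ⟩
      n + ⌈log₂ n ⌉ * (n + n)                         ∎
      where open ≤-Reasoning

algorithm : Algorithm
algorithm n pA M = toQTree (decide pA M)

theorem24 : Σ Algorithm λ alg →
    ((n : ℕ) (pA : Profile n) (M : Matching n) (pB : Profile n) →
    T (output (alg n pA M) pB) ⇔ (Stable pA pB M × BOptimal pA pB M))
    × Σ ℕ λ c → Σ ℕ λ N → (n : ℕ) → N ≤ n →
    (pA : Profile n) (M : Matching n) (pB : Profile n) →
    queries (alg n pA M) pB ≤ c * (n * ⌈log₂ n ⌉)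
theorem24 = algorithm , correct , 3 , 2 , bound
  where
  correct : ∀ n pA M pB → T (output (algorithm n pA M) pB) ⇔ (Stable pA pB M × BOptimal pA pB M)
  correct n pA M pB rewrite output-toQTree pB (decide pA M) = decide-correct pA M pB

  bound : ∀ n → 2 ≤ n → ∀ pA M pB → queries (algorithm n pA M) pB ≤ 3 * (n * ⌈log₂ n ⌉)
  bound n 2≤n pA M pB = begin
    queries (algorithm n pA M) pB       ≡⟨ queries-toQTree pB (decide pA M) ⟩
    cost pB (decide pA M)               ≤⟨ cost-decide pA M pB ⟩
    n + L * (n + n)                     ≡⟨ cong₂ _+_ (sym (*-identityʳ n)) (trans (*-comm L (n + n)) (*-distribʳ-+ L n n)) ⟩
    -- For n at least 2 the logarithm is at least 1, which absorbs the n stability queries. With two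
    -- further terms from the sweeps the constant is 3.
    n * 1 + (n * L + n * L)             ≤⟨ +-monoˡ-≤ _ (*-monoʳ-≤ n (⌈log₂⌉-mono-≤ {2} {n} 2≤n)) ⟩
    n * L + (n * L + n * L)             ≡⟨ cong (λ z → n * L + (n * L + z)) (sym (+-identityʳ _)) ⟩
    3 * (n * L)                         ∎
    where
    open ≤-Reasoning
    L = ⌈log₂ n ⌉
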